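{- Closure under Boolean operations (union, intersection, and complementation) transfers from component automata to temporalized ones: given two classes $\mathcal{A}_1$ and $\mathcal{A}_2$ of automata which are (effectively) closed under Boolean operations, the class $\mathcal{A}_1(\mathcal{A}_2)$ of temporalized automata is (effectively) closed under Boolean operations. That is, if $\mathcal{A}_1$ and $\mathcal{A}_2$ are closed under Boolean operations, so is $\mathcal{A}_1(\mathcal{A}_2)$; and if $\mathcal{A}_1$ and $\mathcal{A}_2$ are effectively closed under Boolean operations, so is $\mathcal{A}_1(\mathcal{A}_2)$.
   Context: For a finite alphabet $\Sigma$, $\mathcal{S}(\Sigma)$ is the set of $\Sigma$-labeled infinite sequences $(\mathbb{N},<,V)$ with $V:\mathbb{N}\to\Sigma$. Sequence automata. A sequence automaton $A$ over $\Sigma$ consists of (i) a labeled transition system $(Q,q_0,\Delta,M,\Omega)$, where $Q$ is a finite set of states, $q_0\in Q$ is the initial state, $\Delta\subseteq Q\times\Sigma\times Q$ is a transition relation, $\Omega$ is a finite alphabet, and $M\subseteq Q\times\Omega$ is a labeling of states, and (ii) an acceptance condition $AC$. A run of $A$ on $(\mathbb{N},<,V)$ is a function $\sigma:\mathbb{N}\to Q$ with $\sigma(0)=q_0$ and $(\sigma(i),V(i),\sigma(i+1))\in\Delta$ for every $i\ge 0$. $A$ accepts the sequence if there is a run $\sigma$ of $A$ on it such that $AC(\sigma)$, i.e. the acceptance condition holds on $\sigma$; $\mathcal{L}(A)$ is the set of accepted sequences. A class of sequence automata is a set of automata that share the acceptance condition $AC$; no specific acceptance condition is assumed. (Example: Büchi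 automata, where $\Omega=\{\mathtt{final}\}$ and $AC(\sigma)$ says that some $q$ with $(q,\mathtt{final})\in M$ occurs infinitely often in $\sigma$.) Temporalized automata. Let $\mathcal{A}_2$ be a class of sequence automata accepting sequences in $\mathcal{S}(\Sigma)$, let $\Gamma(\Sigma)$ be a finite alphabet whose symbols denote automata in $\mathcal{A}_2$, and let $\mathcal{A}_1$ be a class of sequence automata accepting sequences in $\mathcal{S}(\Gamma(\Sigma))$. Let $\mathcal{S}(\mathcal{S}(\Sigma))$ be the set of structures $(\mathbb{N},<,g)$ with $g:\mathbb{N}\to\mathcal{S}(\Sigma)$ a total function. A temporalized automaton $A$ over $\Gamma(\Sigma)$, in the class $\mathcal{A}_1(\mathcal{A}_2)$, is a quintuple $(Q,q_0,\Delta,M,\Omega)$ as for sequence automata (with $\Delta\subseteq Q\times\Gamma(\Sigma)\times Q$), with the following combined acceptance condition. A run of $A$ on $(\mathbb{N},<,g)\in\mathcal{S}(\mathcal{S}(\Sigma))$ is a function $\sigma:\mathbb{N}\to Q$ with $\sigma(0)=q_0$ such that for every $i\ge 0$ there is $B\in\Gamma(\Sigma)$ with $(\sigma(i),B,\sigma(i+1))\in\Delta$ and $g(i)\in\mathcal{L}(B)$. $A$ accepts $(\mathbb{N},<,g)$ if there is a run $\sigma$ of $A$ on it such that $AC(\sigma)$, where $AC$ is the acceptance condition of $\mathcal{A}_1$; $\mathcal{L}(A)$ is the set of elements of $\mathcal{S}(\mathcal{S}(\Sigma))$ accepted by $A$. Each $A\in\mathcal{A}_1(\mathcal{A}_2)$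 has an abstraction, the automaton in $\mathcal{A}_1$ with the same labeled transition system and the acceptance condition of $\mathcal{A}_1$; conversely each automaton in $\mathcal{A}_1$ has a concretization, the automaton in $\mathcal{A}_1(\mathcal{A}_2)$ with the same labeled transition system and the combined acceptance condition. Closure. A class is closed under Boolean operations if the union, the intersection and the complement of languages recognized by automata of the class are recognized by automata of the class (complements being relative to the set of all structures of the kind the automata accept, e.g. $\mathcal{S}(\mathcal{S}(\Sigma))$ for $\mathcal{A}_1(\mathcal{A}_2)$); it is effectively closed if such automata can be effectively computed from the given ones. -}

module Defs where

open import Axiom.ExcludedMiddle using (ExcludedMiddle)
open import Data.Fin using (Fin)
open import Data.Fin.Subset using (Subset; _∈_)
open import Data.Nat using (ℕ; zero; suc; NonZero)
open import Data.Product using (_×_; ∃; Σ-syntax)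
open import Data.Refinement using (Refinement; value)
open import Level using (0ℓ)
open import Relation.Binary.PropositionalEquality using (_≡_)
open import Relation.Unary using (Pred; _≐_; _∪_; _∩_; ∁)

-- An alphabet with s letters is Fin s; 𝒮 s is the set of sequences labelled
-- by it, and 𝒮𝒮 s the set of sequences of such sequences.
𝒮 : ℕ → Set
𝒮 s = ℕ → Fin s

𝒮𝒮 : ℕ → Set
𝒮𝒮 s = ℕ → 𝒮 s

-- Everything is first-order finite data, so that computing with transition
-- systems is meaningful.  q′ ∈ Δ q a means (q , a , q′) ∈ Δ, and o ∈ M q
-- means (q , o) ∈ M.
record LTS (s : ℕ) : Set where
  field
    ∣Q∣ : ℕ
    q₀  : Fin ∣Q∣
    Δ   : Fin ∣Q∣ → Fin s → Subset ∣Q∣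
    ∣Ω∣ : ℕ
    M   : Fin ∣Q∣ → Subset ∣Ω∣

-- An acceptance condition is a property of state sequences σ, expressed
-- through the labelling M of the states.
AcceptanceCondition : Set₁
AcceptanceCondition = ∀ {n m} → (Fin n → Subset m) → (ℕ → Fin n) → Set

record IsRun {s} (A : LTS s) (V : 𝒮 s) (σ : ℕ → Fin (LTS.∣Q∣ A)) : Set where
  open LTS A
  field
    initial : σ zero ≡ q₀
    step    : ∀ i → σ (suc i) ∈ Δ (σ i) (V i)

record Class (s : ℕ) : Set₁ where
  field
    Member : LTS s → Set
    AC     : AcceptanceCondition

-- Membership in the class is proof-irrelevant: operations on automata only
-- see the transition system.
Automaton : ∀ {s} → Class s → Set
Automaton {s} 𝒞 = Refinement (LTS s) (Class.Member 𝒞)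

ℒ : ∀ {s} (𝒞 : Class s) → Automaton 𝒞 → Pred (𝒮 s) 0ℓ
ℒ 𝒞 A V = ∃ λ σ → IsRun (value A) V σ × Class.AC 𝒞 (LTS.M (value A)) σ

-- A class that makes sense over every alphabet at once (Büchi, Muller,
-- Rabin, ...): all automata with the given acceptance condition and an
-- admissible state labelling (e.g. Ω = {final} for Büchi automata), with no
-- restriction on the transition relation.
record ClassScheme : Set₁ where
  field
    Admissible : ∀ {n m} → (Fin n → Subset m) → Set
    AC         : AcceptanceCondition

  over : ∀ s → Class s
  over s = record { Member = λ A → Admissible (LTS.M A) ; AC = AC }

-- Γ is a nonempty finite alphabet whose letters denote automata of 𝒜₂ (two
-- letters may denote the same one).  The transition system over Γ is the
-- abstraction; any automaton over Γ in 𝒜₁ arises, via its concretization.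
record TemporalizedAutomaton {s} (𝒜₁ : ClassScheme) (𝒜₂ : Class s) : Set where
  field
    ∣Γ∣           : ℕ
    .{{nonEmpty}} : NonZero ∣Γ∣
    denotes       : Fin ∣Γ∣ → Automaton 𝒜₂
    abstraction   : Automaton (ClassScheme.over 𝒜₁ ∣Γ∣)

record IsTemporalizedRun {s} {𝒜₁ : ClassScheme} {𝒜₂ : Class s}
                         (A : TemporalizedAutomaton 𝒜₁ 𝒜₂) (g : 𝒮𝒮 s)
                         (σ : ℕ → Fin (LTS.∣Q∣ (value (TemporalizedAutomaton.abstraction A))))
                         : Set where
  open TemporalizedAutomaton A
  open LTS (value abstraction)
  field
    initial : σ zero ≡ q₀
    step    : ∀ i → ∃ λ B → σ (suc i) ∈ Δ (σ i) B × ℒ 𝒜₂ (denotes B) (g i)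

ℒᵀ : ∀ {s} (𝒜₁ : ClassScheme) (𝒜₂ : Class s) →
     TemporalizedAutomaton 𝒜₁ 𝒜₂ → Pred (𝒮𝒮 s) 0ℓ
ℒᵀ 𝒜₁ 𝒜₂ A g = ∃ λ σ →
  IsTemporalizedRun A g σ ×
  ClassScheme.AC 𝒜₁ (LTS.M (value (TemporalizedAutomaton.abstraction A))) σ

-- In both closure notions Aut is the type of automata of a class, X the
-- type of structures they accept, and L assigns to each automaton the
-- language it recognizes.
BooleanClosed : {Aut X : Set} → (Aut → Pred X 0ℓ) → Set
BooleanClosed L =
  (∀ A B → ∃ λ C → L C ≐ L A ∪ L B) ×
  (∀ A B → ∃ λ C → L C ≐ L A ∩ L B) ×
  (∀ A   → ∃ λ C → L C ≐ ∁ (L A))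

-- The automata are computed without access to excluded middle; classical
-- logic is available only for the proof that they are correct.
EffectivelyBooleanClosed : {Aut X : Set} → (Aut → Pred X 0ℓ) → Set₁
EffectivelyBooleanClosed {Aut} L =
  Σ[ union        ∈ (Aut → Aut → Aut) ]
  Σ[ intersection ∈ (Aut → Aut → Aut) ]
  Σ[ complement   ∈ (Aut → Aut) ]
  (ExcludedMiddle 0ℓ →
    (∀ A B → L (union A B) ≐ L A ∪ L B) ×
    (∀ A B → L (intersection A B) ≐ L A ∩ L B) ×
    (∀ A   → L (complement A) ≐ ∁ (L A)))

{-# OPTIONS --safe #-}
-- Let D be a finite family of automata containing all those denoted by the
-- letters of the given temporalized automata.  The Boolean combinations of D
-- in which every member occurs, either complemented or not, partition the set
-- of sequences into cells, and closure of the second class makes each cell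
-- recognizable.  Over the alphabet of cells, every g determines exactly one
-- word: a temporalized automaton whose letters denote the cells accepts g iff
-- its abstraction accepts this word.  Every temporalized automaton over
-- letters in D can be rewritten over cells, letting a cell act as any of the
-- letters whose language includes it, so the Boolean operations can be
-- carried out on abstractions.
module Submission where

open import Defs
open import Axiom.ExcludedMiddle using (ExcludedMiddle)
open import Data.Bool using (true)
open import Data.Fin using (Fin; zero; suc; combine; finToFun; funToFin; _↑ˡ_; _↑ʳ_; _≟_)
open import Data.Fin.Patterns using (0F; 1F)
open import Data.Fin.Properties using (any?; ∀-cons-⇔; funToFin-finToFin; finToFun-funToFin)
open import Data.Fin.Subset using (Subset; _∈_)
open import Data.Fin.Subset.Properties using (_∈?_)
open import Data.Nat using (ℕ; zero; suc; NonZero; _+_; _^_)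
open import Data.Nat.Properties using (m^n≢0)
open import Data.Product using (_×_; _,_; ∃; proj₁; proj₂)
open import Data.Product.Function.NonDependent.Propositional using (_×-⇔_)
open import Data.Refinement using (Refinement; value)
open import Data.Sum using (_⊎_)
open import Data.Sum.Function.Propositional using (_⊎-⇔_)
open import Data.Vec using (tabulate)
open import Data.Vec.Functional using (_++_)
open import Data.Vec.Functional.Properties using (lookup-++ˡ; lookup-++ʳ)
open import Data.Vec.Properties using ([]=⇒lookup; lookup⇒[]=; lookup∘tabulate)
open import Function using (id; _∘_; _⇔_; mk⇔; Equivalence)
open import Function.Properties.Equivalence using () renaming (refl to ⇔-refl; sym to ⇔-sym; trans to ⇔-trans)
open import Function.Related.TypeIsomorphisms using (¬-cong-⇔)
open import Level using (0ℓ)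
open import Relation.Binary.PropositionalEquality
  using (_≡_; _≗_; refl; sym; trans; cong₂; subst)
open import Relation.Nullary using (¬_; Dec; yes; no; does; contradiction)
open import Relation.Nullary.Decidable using (_×-dec_; dec-true)
open import Relation.Unary using (Pred; Decidable; _≐_)

open Equivalence using (to; from)

-- Equivalences, finite codings and decidable subsets

≐⇒⇔ : {X : Set} {P Q : Pred X 0ℓ} → P ≐ Q → ∀ {x} → P x ⇔ Q x
≐⇒⇔ (P⊆Q , Q⊆P) = mk⇔ P⊆Q Q⊆P

⇔⇒≐ : {X : Set} {P Q : Pred X 0ℓ} → (∀ {x} → P x ⇔ Q x) → P ≐ Q
⇔⇒≐ P⇔Q = to P⇔Q , from P⇔Q

+-nonZero : ∀ m n → .{{NonZero m}} → NonZero (m + n)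
+-nonZero (suc m) n = _

funToFin-cong : ∀ {m n} {f g : Fin m → Fin n} → f ≗ g → funToFin f ≡ funToFin g
funToFin-cong {zero}  f≗g = refl
funToFin-cong {suc m} f≗g = cong₂ combine (f≗g zero) (funToFin-cong (f≗g ∘ suc))

-- The two codings are mutually inverse; comparing functions pointwise avoids function
-- extensionality.
finToFun≗⇔≡funToFin : ∀ {m n} (a : Fin (m ^ n)) (f : Fin n → Fin m) →
                      finToFun a ≗ f ⇔ a ≡ funToFin f
finToFun≗⇔≡funToFin {m} {n} a f = mk⇔
  (λ a≗f → trans (sym (funToFin-finToFin {n} {m} a)) (funToFin-cong a≗f))
  λ { refl → finToFun-funToFin f }

comprehension : ∀ {n} {P : Pred (Fin n) 0ℓ} → Decidable P → Subset n
comprehension P? = tabulate (does ∘ P?)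

∈-comprehension : ∀ {n} {P : Pred (Fin n) 0ℓ} (P? : Decidable P) {i} →
                  i ∈ comprehension P? ⇔ P i
∈-comprehension {P = P} P? {i} = mk⇔
  (λ i∈ → witness (P? i) (trans (sym (lookup∘tabulate _ i)) ([]=⇒lookup i∈)))
  (λ p → lookup⇒[]= i _ (trans (lookup∘tabulate _ i) (dec-true (P? i) p)))
  where
  witness : (P?i : Dec (P i)) → does P?i ≡ true → P i
  witness (yes p) _ = p

bit : {P : Set} → Dec P → Fin 2
bit (yes _) = 1F
bit (no _)  = 0F

bit≡1⇔ : {P : Set} (P? : Dec P) → bit P? ≡ 1F ⇔ P
bit≡1⇔ (yes p) = mk⇔ (λ _ → p) (λ _ → refl)
bit≡1⇔ (no ¬p) = mk⇔ (λ ()) (λ p → contradiction p ¬p)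

-- Cells of a finite family of languages

module Cells {X Aut : Set} {L : Aut → Pred X 0ℓ} (closed : EffectivelyBooleanClosed L) where

  private
    intersection = proj₁ (proj₂ closed)
    complement   = proj₁ (proj₂ (proj₂ closed))
    correct      = proj₂ (proj₂ (proj₂ closed))

  literal : Fin 2 → Aut → Aut
  literal 0F = complement
  literal 1F B = B

  -- The empty intersection is excluded: it would be all of `X`, and there is no automaton at hand
  -- to build one for `X` from.
  ⋂ : ∀ {n} → .{{NonZero n}} → (Fin n → Aut) → Aut
  ⋂ {suc zero}    B = B zero
  ⋂ {suc (suc n)} B = intersection (B zero) (⋂ (B ∘ suc))

  -- The index `a` codes a sign vector: bit `1F` keeps a member, bit `0F` complements it.
  cell : ∀ {n} → .{{NonZero n}} → (Fin n → Aut) → Fin (2 ^ n) → Aut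
  cell B a = ⋂ λ j → literal (finToFun a j) (B j)

  module _ (em : ExcludedMiddle 0ℓ) where

    -- The index of the cell containing `x`. It needs excluded middle, so it occurs only in
    -- correctness proofs, never in a construction.
    profile : ∀ {n} → (Fin n → Aut) → X → Fin (2 ^ n)
    profile B x = funToFin λ j → bit (em {L (B j) x})

    ∈-literal : ∀ d B {x} → L (literal d B) x ⇔ d ≡ bit (em {L B x})
    ∈-literal 0F B {x} with em {L B x} | ≐⇒⇔ (proj₂ (proj₂ (correct em)) B) {x}
    ... | yes p | ∁⇔ = mk⇔ (λ q → contradiction p (to ∁⇔ q)) (λ ())
    ... | no ¬p | ∁⇔ = mk⇔ (λ _ → refl) (λ _ → from ∁⇔ ¬p)
    ∈-literal 1F B {x} with em {L B x}
    ... | yes p = mk⇔ (λ _ → refl) (λ _ → p)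
    ... | no ¬p = mk⇔ (λ p → contradiction p ¬p) (λ ())

    ∈-⋂ : ∀ {n} .{{_ : NonZero n}} (B : Fin n → Aut) {x} → L (⋂ B) x ⇔ (∀ j → L (B j) x)
    ∈-⋂ {suc zero}    B = mk⇔ (λ { p zero → p }) (λ p → p zero)
    ∈-⋂ {suc (suc n)} B = ⇔-trans
      (≐⇒⇔ (proj₁ (proj₂ (correct em)) (B zero) (⋂ (B ∘ suc)))) (⇔-trans
      (⇔-refl ×-⇔ ∈-⋂ (B ∘ suc))
      ∀-cons-⇔)

    -- Lying in every literal means that the signs of `a` agree with the membership bits of `x`, and
    -- these bits determine `a`. So the cells partition `X`.
    ∈-cell : ∀ {n} .{{_ : NonZero n}} (B : Fin n → Aut) a {x} →
             L (cell B a) x ⇔ a ≡ profile B x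
    ∈-cell B a {x} = ⇔-trans (∈-⋂ _) (⇔-trans
      (mk⇔ (λ p j → to (∈-literal _ (B j)) (p j)) (λ p j → from (∈-literal _ (B j)) (p j)))
      (finToFun≗⇔≡funToFin a _))

    profile-bit≡1⇔ : ∀ {n} (B : Fin n → Aut) j {x} → finToFun (profile B x) j ≡ 1F ⇔ L (B j) x
    profile-bit≡1⇔ B j {x} = subst (λ b → b ≡ 1F ⇔ L (B j) x)
      (sym (finToFun-funToFin (λ j → bit (em {L (B j) x})) j)) (bit≡1⇔ em)

-- Boolean operations on temporalized automata

module Transfer {s : ℕ} {𝒜₁ : ClassScheme} {𝒜₂ : Class s}
                (closed₁ : ∀ k → .{{_ : NonZero k}} →
                           EffectivelyBooleanClosed (ℒ (ClassScheme.over 𝒜₁ k)))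
                (closed₂ : EffectivelyBooleanClosed (ℒ 𝒜₂)) where

  open ClassScheme 𝒜₁ using (over)
  open Cells closed₂ using (cell; profile; ∈-cell; profile-bit≡1⇔)
  open TemporalizedAutomaton using (∣Γ∣; denotes; abstraction)

  -- The field nonEmpty is irrelevant and cannot be projected under --safe.
  ∣Γ∣-nonZero : (A : TemporalizedAutomaton 𝒜₁ 𝒜₂) → NonZero (∣Γ∣ A)
  ∣Γ∣-nonZero record { ∣Γ∣ = zero  ; nonEmpty = () }
  ∣Γ∣-nonZero record { ∣Γ∣ = suc _ }                  = _

  overCells : ∀ {n} → .{{NonZero n}} → (Fin n → Automaton 𝒜₂) → Automaton (over (2 ^ n)) →
              TemporalizedAutomaton 𝒜₁ 𝒜₂
  overCells {n} D C = record
    { ∣Γ∣         = 2 ^ n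
    ; nonEmpty    = m^n≢0 2 n
    ; denotes     = cell D
    ; abstraction = C
    }

  -- The labelling `M` is unchanged, so admissibility carries over and `AC` judges the same state
  -- sequences. Decidability of `R` makes the new `Δ` a computed table.
  relabel : ∀ {k l} {R : Fin l → Fin k → Set} → (∀ a b → Dec (R a b)) →
            Automaton (over k) → Automaton (over l)
  relabel R? C = record
    { value = record
      { ∣Q∣ = ∣Q∣
      ; q₀  = q₀
      ; Δ   = λ q a → comprehension λ q′ → any? λ b → R? a b ×-dec (q′ ∈? Δ q b)
      ; ∣Ω∣ = ∣Ω∣
      ; M   = M
      }
    ; proof = Refinement.proof C
    }
    where open LTS (value C)

  ∈-relabel : ∀ {k l} {R : Fin l → Fin k → Set} (R? : ∀ a b → Dec (R a b)) C {q a q′} →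
              q′ ∈ LTS.Δ (value (relabel R? C)) q a ⇔
              (∃ λ b → R a b × q′ ∈ LTS.Δ (value C) q b)
  ∈-relabel R? C = ∈-comprehension λ q′ → any? λ b → R? _ b ×-dec (q′ ∈? LTS.Δ (value C) _ b)

  -- Inclusion of a cell in a letter's language is tested on the sign vector, so no question about
  -- languages has to be decided.
  includedIn? : ∀ {k n} (ι : Fin k → Fin n) (a : Fin (2 ^ n)) b → Dec (finToFun a (ι b) ≡ 1F)
  includedIn? ι a b = finToFun a (ι b) ≟ 1F

  rewriteOverCells : ∀ {n} (A : TemporalizedAutomaton 𝒜₁ 𝒜₂) → (Fin (∣Γ∣ A) → Fin n) →
                     Automaton (over (2 ^ n))
  rewriteOverCells A ι = relabel (includedIn? ι) (abstraction A)

  module _ (em : ExcludedMiddle 0ℓ) where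

    word : ∀ {n} → (Fin n → Automaton 𝒜₂) → 𝒮𝒮 s → 𝒮 (2 ^ n)
    word D g i = profile em D (g i)

    -- The same `σ` serves on both sides: `g i` lies in exactly one cell, so the letter read at step
    -- `i` is forced.
    ℒᵀ-overCells : ∀ {n} .{{_ : NonZero n}} (D : Fin n → Automaton 𝒜₂) C {g} →
                   ℒᵀ 𝒜₁ 𝒜₂ (overCells D C) g ⇔ ℒ (over (2 ^ n)) C (word D g)
    ℒᵀ-overCells D C {g} = mk⇔
      (λ (σ , r , ac) → σ , record
        { initial = IsTemporalizedRun.initial r
        ; step    = λ i → let (a , σ∈ , g∈) = IsTemporalizedRun.step r i in
                          subst (λ a → σ (suc i) ∈ LTS.Δ (value C) (σ i) a)
                                (to (∈-cell em D a) g∈) σ∈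
        } , ac)
      (λ (σ , r , ac) → σ , record
        { initial = IsRun.initial r
        ; step    = λ i → word D g i , IsRun.step r i , from (∈-cell em D (word D g i)) refl
        } , ac)

    -- Again `σ` is kept: the letters of `A` whose language contains `g i` are exactly those with
    -- bit `1F` in the `i`-th letter of `word D g`. The family `D` may have further members.
    ℒ-rewriteOverCells : ∀ {n} (D : Fin n → Automaton 𝒜₂) A ι → D ∘ ι ≗ denotes A → ∀ {g} →
                         ℒᵀ 𝒜₁ 𝒜₂ A g ⇔ ℒ (over (2 ^ n)) (rewriteOverCells A ι) (word D g)
    ℒ-rewriteOverCells D A ι D∘ι≗ {g} = mk⇔
      (λ (σ , r , ac) → σ , record
        { initial = IsTemporalizedRun.initial r
        ; step    = λ i → let (b , σ∈ , g∈) = IsTemporalizedRun.step r i in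
                          from (∈-relabel (includedIn? ι) (abstraction A)) (b , from (letter⇔ i b) g∈ , σ∈)
        } , ac)
      (λ (σ , r , ac) → σ , record
        { initial = IsRun.initial r
        ; step    = λ i → let (b , bit≡1 , σ∈) = to (∈-relabel (includedIn? ι) (abstraction A)) (IsRun.step r i) in
                          b , σ∈ , to (letter⇔ i b) bit≡1
        } , ac)
      where
      letter⇔ : ∀ i b → finToFun (word D g i) (ι b) ≡ 1F ⇔ ℒ 𝒜₂ (denotes A b) (g i)
      letter⇔ i b = subst (λ E → finToFun (word D g i) (ι b) ≡ 1F ⇔ ℒ 𝒜₂ E (g i))
                          (D∘ι≗ b) (profile-bit≡1⇔ em D (ι b))

  -- Concatenating the two families gives one cell alphabet, so that both rewritten abstractions are
  -- run on the same word.
  overJointCells : (∀ k → .{{_ : NonZero k}} → (A B : Automaton (over k)) → Automaton (over k)) →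
                   (A B : TemporalizedAutomaton 𝒜₁ 𝒜₂) → TemporalizedAutomaton 𝒜₁ 𝒜₂
  overJointCells op A B = overCells {{+-nonZero (∣Γ∣ A) (∣Γ∣ B) {{∣Γ∣-nonZero A}}}} (denotes A ++ denotes B)
    (op (2 ^ (∣Γ∣ A + ∣Γ∣ B)) {{m^n≢0 2 (∣Γ∣ A + ∣Γ∣ B)}}
      (rewriteOverCells A (_↑ˡ ∣Γ∣ B)) (rewriteOverCells B (∣Γ∣ A ↑ʳ_)))

  -- Abstracting over the connective `_∙_` treats union and intersection at once.
  ℒᵀ-overJointCells : ExcludedMiddle 0ℓ → ∀ op (_∙_ : Set → Set → Set) →
    (∀ {P P′ Q Q′} → P ⇔ P′ → Q ⇔ Q′ → (P ∙ Q) ⇔ (P′ ∙ Q′)) →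
    (∀ k .{{_ : NonZero k}} A B {V} →
      ℒ (over k) (op k A B) V ⇔ (ℒ (over k) A V ∙ ℒ (over k) B V)) →
    ∀ A B {g} → ℒᵀ 𝒜₁ 𝒜₂ (overJointCells op A B) g ⇔ (ℒᵀ 𝒜₁ 𝒜₂ A g ∙ ℒᵀ 𝒜₁ 𝒜₂ B g)
  ℒᵀ-overJointCells em op _∙_ ∙-cong op⇔ A B =
    ⇔-trans (ℒᵀ-overCells em {{+-nonZero (∣Γ∣ A) (∣Γ∣ B) {{∣Γ∣-nonZero A}}}} D _) (⇔-trans
      (op⇔ _ {{m^n≢0 2 (∣Γ∣ A + ∣Γ∣ B)}} _ _)
      (⇔-sym (∙-cong
        (ℒ-rewriteOverCells em D A (_↑ˡ ∣Γ∣ B) (lookup-++ˡ (denotes A) (denotes B)))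
        (ℒ-rewriteOverCells em D B (∣Γ∣ A ↑ʳ_) (lookup-++ʳ (denotes A) (denotes B))))))
    where D = denotes A ++ denotes B

  -- Complementing the abstraction directly over the letters of `A` would fail: their languages may
  -- overlap, so one `g` can match both accepted and rejected words. Over cells it matches a single
  -- word.
  complement : TemporalizedAutomaton 𝒜₁ 𝒜₂ → TemporalizedAutomaton 𝒜₁ 𝒜₂
  complement A = overCells {{∣Γ∣-nonZero A}} (denotes A)
    (proj₁ (proj₂ (proj₂ (closed₁ (2 ^ ∣Γ∣ A) {{m^n≢0 2 (∣Γ∣ A)}}))) (rewriteOverCells A id))

  ℒᵀ-complement : ExcludedMiddle 0ℓ → ∀ A {g} →
                  ℒᵀ 𝒜₁ 𝒜₂ (complement A) g ⇔ (¬ ℒᵀ 𝒜₁ 𝒜₂ A g)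
  ℒᵀ-complement em A =
    ⇔-trans (ℒᵀ-overCells em {{∣Γ∣-nonZero A}} (denotes A) _) (⇔-trans
      (≐⇒⇔ (proj₂ (proj₂ (correct em)) _))
      (⇔-sym (¬-cong-⇔ (ℒ-rewriteOverCells em (denotes A) A id (λ _ → refl)))))
    where correct = proj₂ (proj₂ (proj₂ (closed₁ (2 ^ ∣Γ∣ A) {{m^n≢0 2 (∣Γ∣ A)}})))

  temporalized-effectivelyBooleanClosed : EffectivelyBooleanClosed (ℒᵀ 𝒜₁ 𝒜₂)
  temporalized-effectivelyBooleanClosed =
    overJointCells ∪₁ , overJointCells ∩₁ , complement , λ em →
      (λ A B → ⇔⇒≐ (ℒᵀ-overJointCells em ∪₁ _⊎_ _⊎-⇔_
        (λ k A B → ≐⇒⇔ (proj₁ (correct k em) A B)) A B)) ,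
      (λ A B → ⇔⇒≐ (ℒᵀ-overJointCells em ∩₁ _×_ _×-⇔_
        (λ k A B → ≐⇒⇔ (proj₁ (proj₂ (correct k em)) A B)) A B)) ,
      (λ A → ⇔⇒≐ (ℒᵀ-complement em A))
    where
    ∪₁ ∩₁ : ∀ k → .{{_ : NonZero k}} → (A B : Automaton (over k)) → Automaton (over k)
    ∪₁ k = proj₁ (closed₁ k)
    ∩₁ k = proj₁ (proj₂ (closed₁ k))
    correct = λ k .{{_ : NonZero k}} → proj₂ (proj₂ (proj₂ (closed₁ k)))

-- Passing between plain and effective closure

-- A constructive existence proof carries its witness, so projecting out the automata yields the
-- operations.
booleanClosed⇒effectively : {Aut X : Set} {L : Aut → Pred X 0ℓ} →
                            BooleanClosed L → EffectivelyBooleanClosed L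
booleanClosed⇒effectively (∪-closed , ∩-closed , ∁-closed) =
  (λ A B → proj₁ (∪-closed A B)) , (λ A B → proj₁ (∩-closed A B)) , (λ A → proj₁ (∁-closed A)) ,
  λ _ → (λ A B → proj₂ (∪-closed A B)) , (λ A B → proj₂ (∩-closed A B)) , (λ A → proj₂ (∁-closed A))

effectively⇒booleanClosed : {Aut X : Set} {L : Aut → Pred X 0ℓ} → ExcludedMiddle 0ℓ →
                            EffectivelyBooleanClosed L → BooleanClosed L
effectively⇒booleanClosed em (union , intersection , complement , correct) =
  (λ A B → union A B , proj₁ (correct em) A B) ,
  (λ A B → intersection A B , proj₁ (proj₂ (correct em)) A B) ,
  (λ A → complement A , proj₂ (proj₂ (correct em)) A)

theorem2p7 : (s : ℕ) (𝒜₁ : ClassScheme) (𝒜₂ : Class s) →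
    (ExcludedMiddle 0ℓ →
    (∀ k → .{{_ : NonZero k}} → BooleanClosed (ℒ (ClassScheme.over 𝒜₁ k))) →
    BooleanClosed (ℒ 𝒜₂) →
    BooleanClosed (ℒᵀ 𝒜₁ 𝒜₂))
    ×
    ((∀ k → .{{_ : NonZero k}} → EffectivelyBooleanClosed (ℒ (ClassScheme.over 𝒜₁ k))) →
    EffectivelyBooleanClosed (ℒ 𝒜₂) →
    EffectivelyBooleanClosed (ℒᵀ 𝒜₁ 𝒜₂))
theorem2p7 s 𝒜₁ 𝒜₂ =
  (λ em closed₁ closed₂ → effectively⇒booleanClosed em
    (Transfer.temporalized-effectivelyBooleanClosed
      (λ k → booleanClosed⇒effectively (closed₁ k)) (booleanClosed⇒effectively closed₂))) ,
  λ closed₁ closed₂ → Transfer.temporalized-effectivelyBooleanClosed closed₁ closed₂
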